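{- For any finite simple graph $G$, \[\mathrm{mr}(G,\mathbb{F}_2) = \min\{c_2(G),\, 2t_2(G)\}.\]
   Context: All graphs are finite and simple. A subgraph complementation system for a graph $G=(V,E)$ is a finite collection (family) $\mathscr{C}$ of subsets of $V$ such that, for any two distinct vertices $u,v\in V$, $uv\in E$ if and only if $u$ and $v$ appear together in an odd number of sets in $\mathscr{C}$. The subgraph complementation number $c_2(G)$ is the minimum cardinality of a subgraph complementation system for $G$. A symmetric matrix over a field $\mathbb{F}$ with rows and columns indexed by $V$ fits $G$ if, for distinct $u,v$, its $(u,v)$ entry is nonzero if and only if $uv\in E$ (the diagonal is arbitrary). $\mathrm{mr}(G,\mathbb{F})$ is the minimum rank over $\mathbb{F}$ of a symmetric matrix over $\mathbb{F}$ which fits $G$. A complete tripartite graph (triclique) on a subset of $V$ is given by three pairwise disjoint, possibly empty, subsets $X,Y,Z$ of $V$; its vertex set is $X\cup Y\cup Z$ and two vertices are adjacent in it if and only if they lie in different sets among $X,Y,Z$. $t_2(G)$ is the minimum cardinality of a finite collection of complete tripartite graphs on subsets of $V$ such that each pair of distinct vertices of $V$ is adjacent in an odd number of these complete tripartite graphs if and only if it is adjacent in $G$ (i.e. the symmetric difference of their edge sets is $E$). -}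

module Defs where

open import Data.Empty using (⊥-elim-irr)
open import Data.Fin.Base using (Fin; zero; suc)
open import Data.Fin.Properties using (_≟_; all?; any?; injective⇒≤)
open import Data.Fin.Subset using (Subset; _∈_; _∩_; _∪_; ⁅_⁆; ⊥; Empty)
open import Data.Fin.Subset.Properties
  using (_∈?_; nonempty?; anySubset?; x∈⁅x⁆; x∈⁅y⁆⇒x≡y; x∈p∪q⁺; x∈p∪q⁻; x∈p∩q⁻; ∉⊥)
open import Data.List.Base as List using (List; cartesianProduct; allFin)
open import Data.List.Membership.Propositional using () renaming (_∈_ to _∈ˡ_)
open import Data.List.Membership.Propositional.Properties using (∈-cartesianProduct⁺; ∈-allFin)
open import Data.List.Relation.Unary.Any using (here; there)
open import Data.Nat.Base using (ℕ; zero; suc; _≤_; z≤n; s≤s; s≤s⁻¹; parity)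
open import Data.Nat.Properties using (≤∧≢⇒<)
import Data.Nat.Properties as ℕ
open import Data.Parity.Base using (Parity; 0ℙ; 1ℙ; _+_; _*_)
import Data.Parity.Properties as ℙ
open import Data.Product.Base using (Σ; ∃; ∃₂; _×_; _,_; proj₁; proj₂)
open import Data.Sum.Base using (_⊎_; inj₁; inj₂)
open import Data.Vec.Base as Vec using (Vec; []; _∷_; lookup; tabulate; count)
open import Data.Vec.Properties using (lookup∘tabulate; lookup-map)
open import Function.Base using (_∘_)
open import Function.Bundles using (_⇔_; mk⇔; Equivalence)
open import Level using (0ℓ)
open import Relation.Binary.Core using (Rel)
import Relation.Binary.Definitions as B
open import Relation.Binary.PropositionalEquality
open import Relation.Nullary using (¬_; Dec; yes; no; contradiction)
open import Relation.Nullary.Decidable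
  using (map′; ¬?; _×-dec_; _⊎-dec_; _→-dec_; decidable-stable)
open import Relation.Unary using (Pred; Decidable)
open import Algebra.Properties.CommutativeMonoid.Sum ℙ.+-0-commutativeMonoid
  using (sum; sum-cong-≗; sum-replicate-zero; ∑-distrib-+)

private
  variable
    n k : ℕ

record Graph (n : ℕ) : Set₁ where
  field
    Adj    : Rel (Fin n) 0ℓ
    adj?   : B.Decidable Adj
    symm   : B.Symmetric Adj
    irrefl : B.Irreflexive _≡_ Adj

open Graph

IsMinimum : Pred ℕ 0ℓ → ℕ → Set
IsMinimum P m = P m × (∀ k → P k → m ≤ k)

IsMaximum : Pred ℕ 0ℓ → ℕ → Set
IsMaximum P m = P m × (∀ k → P k → k ≤ m)

Odd : ℕ → Set
Odd m = parity m ≡ 1ℙ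

record Triclique (n : ℕ) : Set where
  constructor triclique
  field
    parts     : Vec (Subset n) 3
    -- Irrelevant, so that a triclique is determined by its parts.
    .disjoint : ∀ i j → i ≢ j → Empty (lookup parts i ∩ lookup parts j)

open Triclique public using (parts)

CliqueAdj : Subset n → Rel (Fin n) 0ℓ
CliqueAdj S u v = u ∈ S × v ∈ S

cliqueAdj? : ∀ (u v : Fin n) → Decidable (λ S → CliqueAdj S u v)
cliqueAdj? u v S = u ∈? S ×-dec v ∈? S

TricliqueAdj : Triclique n → Rel (Fin n) 0ℓ
TricliqueAdj T u v =
  ∃₂ λ i j → i ≢ j × u ∈ lookup (parts T) i × v ∈ lookup (parts T) j

tricliqueAdj? : ∀ (u v : Fin n) → Decidable (λ T → TricliqueAdj T u v)
tricliqueAdj? u v T = any? λ i → any? λ j →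
  ¬? (i ≟ j) ×-dec u ∈? lookup (parts T) i ×-dec v ∈? lookup (parts T) j

-- A collection of cardinality k is a vector of length k, so repetitions are
-- allowed; they cancel in pairs and so do not affect the minimum.
IsSubgraphComplementationSystem : Graph n → Vec (Subset n) k → Set
IsSubgraphComplementationSystem G 𝒞 =
  ∀ u v → u ≢ v → Adj G u v ⇔ Odd (count (cliqueAdj? u v) 𝒞)

IsTricliqueSystem : Graph n → Vec (Triclique n) k → Set
IsTricliqueSystem G 𝒯 =
  ∀ u v → u ≢ v → Adj G u v ⇔ Odd (count (tricliqueAdj? u v) 𝒯)

-- The stdlib's commutative ring of parities is the field with two elements.
𝔽₂ : Set
𝔽₂ = Parity

Matrix : ℕ → Set
Matrix n = Vec (Vec 𝔽₂ n) n

_⟦_,_⟧ : Matrix n → Fin n → Fin n → 𝔽₂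
M ⟦ u , v ⟧ = lookup (lookup M u) v

IsSymmetric : Matrix n → Set
IsSymmetric M = ∀ u v → M ⟦ u , v ⟧ ≡ M ⟦ v , u ⟧

Fits : Graph n → Matrix n → Set
Fits G M = ∀ u v → u ≢ v → (M ⟦ u , v ⟧ ≢ 0ℙ) ⇔ Adj G u v

LinearlyIndependent : Vec (Vec 𝔽₂ n) k → Set
LinearlyIndependent {n} {k} xs = ∀ (c : Vec 𝔽₂ k) →
  (∀ (j : Fin n) → sum (λ i → lookup c i * lookup (lookup xs i) j) ≡ 0ℙ) →
  ∀ i → lookup c i ≡ 0ℙ

-- Independence of the family of selected rows forces the selected indices
-- to be distinct.
HasIndependentRows : Matrix n → ℕ → Set
HasIndependentRows {n} M k =
  Σ (Vec (Fin n) k) λ is → LinearlyIndependent (Vec.map (lookup M) is)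

IsRank : Matrix n → ℕ → Set
IsRank M = IsMaximum (HasIndependentRows M)

------------------------------------------------------------------------
-- The optima are found by search, since everything ranges over finite types.
-- The search itself is abstract: `rank`, `mr`, `c₂` and `t₂` are characterised
-- by the types `IsRank`, `IsMinimumRank`, … of the existence lemmas.

private

  minimum : {P : Pred ℕ 0ℓ} → Decidable P → ∀ m → P m → ∃ (IsMinimum P)
  minimum P? zero    p = zero , p , λ _ _ → z≤n
  minimum P? (suc m) p with P? zero
  ... | yes p₀ = zero , p₀ , λ _ _ → z≤n
  ... | no ¬p₀ with minimum (P? ∘ suc) m p
  ...   | l , pl , least = suc l , pl , λ where
            zero    p₀ → contradiction p₀ ¬p₀
            (suc i) pᵢ → s≤s (least i pᵢ)

  maximum : {P : Pred ℕ 0ℓ} → Decidable P → P 0 →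
            ∀ b → (∀ k → P k → k ≤ b) → ∃ (IsMaximum P)
  maximum P? p₀ zero    bound = zero , p₀ , bound
  maximum P? p₀ (suc b) bound with P? (suc b)
  ... | yes p = suc b , p , bound
  ... | no ¬p = maximum P? p₀ b λ i pᵢ →
          s≤s⁻¹ (≤∧≢⇒< (bound i pᵢ) λ { refl → ¬p pᵢ })

  Searchable : Set → Set₁
  Searchable A = {P : Pred A 0ℓ} → Decidable P → Dec (∃ P)

  every? : {A : Set} → Searchable A →
           {P : Pred A 0ℓ} → Decidable P → Dec (∀ a → P a)
  every? search P? = map′
    (λ ¬∃ a → decidable-stable (P? a) λ ¬p → ¬∃ (a , ¬p))
    (λ ∀p (a , ¬p) → ¬p (∀p a))
    (¬? (search (¬? ∘ P?)))

  search-𝔽₂ : Searchable 𝔽₂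
  search-𝔽₂ P? = map′
    (λ { (inj₁ p) → 0ℙ , p ; (inj₂ p) → 1ℙ , p })
    (λ { (0ℙ , p) → inj₁ p ; (1ℙ , p) → inj₂ p })
    (P? 0ℙ ⊎-dec P? 1ℙ)

  search-Vec : {A : Set} → Searchable A → ∀ k → Searchable (Vec A k)
  search-Vec search zero P? = map′ ([] ,_) (λ { ([] , p) → p }) (P? [])
  search-Vec search (suc k) P? = map′
    (λ (x , xs , p) → x ∷ xs , p)
    (λ { (x ∷ xs , p) → x , xs , p })
    (search λ x → search-Vec search k λ xs → P? (x ∷ xs))

  search-Triclique : Searchable (Triclique n)
  search-Triclique {n} {P} P? = map′
    (λ (ps , d , p) → triclique ps d , p)
    (λ { (triclique ps d , p) → ps , decidable-stable (disjoint? ps) (λ ¬d → ⊥-elim-irr (¬d d)) , p })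
    (search-Vec anySubset? 3 λ ps → dep (disjoint? ps) λ d → P? (triclique ps d))
    where
    Disjoint : Vec (Subset n) 3 → Set
    Disjoint ps = ∀ i j → i ≢ j → Empty (lookup ps i ∩ lookup ps j)

    disjoint? : Decidable Disjoint
    disjoint? ps = all? λ i → all? λ j →
      ¬? (i ≟ j) →-dec ¬? (nonempty? (lookup ps i ∩ lookup ps j))

    dep : ∀ {ps} → Dec (Disjoint ps) → (∀ d → Dec (P (triclique ps d))) →
          Dec (Σ (Disjoint ps) λ d → P (triclique ps d))
    dep (no ¬d) f = no (¬d ∘ proj₁)
    dep (yes d) f = map′ (d ,_) proj₂ (f d)

  _⇔-dec_ : {A B : Set} → Dec A → Dec B → Dec (A ⇔ B)
  a? ⇔-dec b? = map′ (λ (f , g) → mk⇔ f g) (λ e → Equivalence.to e , Equivalence.from e)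
    ((a? →-dec b?) ×-dec (b? →-dec a?))

  -- Systems exist as soon as every single pair of vertices is the edge set
  -- of some block.
  module Cover {A : Set} {BlockAdj : A → Rel (Fin n) 0ℓ}
               (blockAdj? : ∀ u v → Decidable (λ a → BlockAdj a u v)) where

    IsSystem : Graph n → Vec A k → Set
    IsSystem G as = ∀ u v → u ≢ v → Adj G u v ⇔ Odd (count (blockAdj? u v) as)

    system? : Searchable A → ∀ G → Decidable (λ k → Σ (Vec A k) (IsSystem G))
    system? search G k = search-Vec search k λ as → all? λ u → all? λ v →
      ¬? (u ≟ v) →-dec (adj? G u v ⇔-dec (parity (count (blockAdj? u v) as) ℙ.≟ 1ℙ))

    SamePair : (i j u v : Fin n) → Set
    SamePair i j u v = (u ≡ i × v ≡ j) ⊎ (u ≡ j × v ≡ i)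

    module Existence
      (blockSym : ∀ a → B.Symmetric (BlockAdj a))
      (edge : ∀ i j → i ≢ j → A)
      (edge-adj : ∀ i j i≢j u v → u ≢ v → BlockAdj (edge i j i≢j) u v ⇔ SamePair i j u v)
      (G : Graph n) where

      Correct : Vec A k → (u v : Fin n) → Set
      Correct as u v = Adj G u v ⇔ Odd (count (blockAdj? u v) as)

      correct? : ∀ (as : Vec A k) u v → Dec (Correct as u v)
      correct? as u v = adj? G u v ⇔-dec (parity (count (blockAdj? u v) as) ℙ.≟ 1ℙ)

      count-sym : ∀ (as : Vec A k) u v → count (blockAdj? u v) as ≡ count (blockAdj? v u) as
      count-sym []       u v = refl
      count-sym (a ∷ as) u v with blockAdj? u v a | blockAdj? v u a
      ... | yes _ | yes _ = cong suc (count-sym as u v)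
      ... | no _  | no _  = count-sym as u v
      ... | yes p | no ¬p = contradiction (blockSym a p) ¬p
      ... | no ¬p | yes p = contradiction (blockSym a p) ¬p

      correct-sym : ∀ (as : Vec A k) u v → Correct as u v → Correct as v u
      correct-sym as u v c = mk⇔
        (λ e → subst Odd (count-sym as u v) (Equivalence.to c (symm G e)))
        (λ o → symm G (Equivalence.from c (subst Odd (sym (count-sym as u v)) o)))

      odd-suc : ∀ m → ¬ Odd m → Odd (suc m)
      odd-suc zero          ¬o = refl
      odd-suc (suc zero)    ¬o = contradiction refl ¬o
      odd-suc (suc (suc m)) ¬o = odd-suc m ¬o

      even-suc : ∀ m → Odd m → ¬ Odd (suc m)
      even-suc zero          ()
      even-suc (suc zero)    _ ()
      even-suc (suc (suc m)) o = even-suc m o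

      flip : ∀ {X : Set} m → Dec X → ¬ (X ⇔ Odd m) → X ⇔ Odd (suc m)
      flip m (yes x) ¬e = mk⇔
        (λ _ → odd-suc m λ o → ¬e (mk⇔ (λ _ → o) (λ _ → x)))
        (λ _ → x)
      flip m (no ¬x) ¬e with parity m ℙ.≟ 1ℙ
      ... | yes o = mk⇔ (λ x → contradiction x ¬x) (λ o′ → contradiction o′ (even-suc m o))
      ... | no ¬o = contradiction
        (mk⇔ (λ x → contradiction x ¬x) (λ o → contradiction o ¬o)) ¬e

      count-edge : ∀ i j i≢j (as : Vec A k) u v → u ≢ v → ¬ SamePair i j u v →
        count (blockAdj? u v) (edge i j i≢j ∷ as) ≡ count (blockAdj? u v) as
      count-edge i j i≢j as u v u≢v ¬same with blockAdj? u v (edge i j i≢j)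
      ... | yes a = contradiction (Equivalence.to (edge-adj i j i≢j u v u≢v) a) ¬same
      ... | no _  = refl

      count-edge-self : ∀ i j i≢j (as : Vec A k) →
        count (blockAdj? i j) (edge i j i≢j ∷ as) ≡ suc (count (blockAdj? i j) as)
      count-edge-self i j i≢j as with blockAdj? i j (edge i j i≢j)
      ... | yes _ = refl
      ... | no ¬a = contradiction
        (Equivalence.from (edge-adj i j i≢j i j i≢j) (inj₁ (refl , refl))) ¬a

      build : (ps : List (Fin n × Fin n)) →
        ∃ λ k → Σ (Vec A k) λ as → ∀ u v → (u , v) ∈ˡ ps → u ≢ v → Correct as u v
      build List.[] = 0 , [] , λ _ _ ()
      build ((i , j) List.∷ ps) with build ps
      ... | k , as , ok with i ≟ j
      ...   | yes refl = k , as , λ where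
                _ _ (here refl) i≢i → contradiction refl i≢i
                u v (there m)       → ok u v m
      ...   | no i≢j with correct? as i j
      ...     | yes c = k , as , λ where
                  _ _ (here refl) _ → c
                  u v (there m)     → ok u v m
      ...     | no ¬c = suc k , edge i j i≢j ∷ as , λ where
                  _ _ (here refl) _   → subst (λ m → Adj G i j ⇔ Odd m)
                    (sym (count-edge-self i j i≢j as)) (flip (count (blockAdj? i j) as) (adj? G i j) ¬c)
                  u v (there m)   u≢v → subst (λ m → Adj G u v ⇔ Odd m)
                    (sym (count-edge i j i≢j as u v u≢v λ where
                      (inj₁ (refl , refl)) → ¬c (ok u v m u≢v)
                      (inj₂ (refl , refl)) → ¬c (correct-sym as u v (ok u v m u≢v))))
                    (ok u v m u≢v)

      system : ∃ λ k → Σ (Vec A k) (IsSystem G)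
      system with build (cartesianProduct (allFin n) (allFin n))
      ... | k , as , ok = k , as , λ u v →
        ok u v (∈-cartesianProduct⁺ (∈-allFin u) (∈-allFin v))

  ∈⁅⁆∪⁅⁆ : ∀ {i j u : Fin n} → u ∈ ⁅ i ⁆ ∪ ⁅ j ⁆ → u ≡ i ⊎ u ≡ j
  ∈⁅⁆∪⁅⁆ {i = i} {j} u∈ with x∈p∪q⁻ ⁅ i ⁆ ⁅ j ⁆ u∈
  ... | inj₁ p = inj₁ (x∈⁅y⁆⇒x≡y i p)
  ... | inj₂ q = inj₂ (x∈⁅y⁆⇒x≡y j q)

  clique-system : (G : Graph n) → ∃ λ k → Σ (Vec (Subset n) k) (IsSubgraphComplementationSystem G)
  clique-system = Cover.Existence.system cliqueAdj?
    (λ _ (p , q) → q , p)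
    (λ i j _ → ⁅ i ⁆ ∪ ⁅ j ⁆)
    λ i j i≢j u v u≢v → mk⇔
      (λ (p , q) → to (∈⁅⁆∪⁅⁆ p) (∈⁅⁆∪⁅⁆ q) u≢v)
      λ where
        (inj₁ (refl , refl)) → x∈p∪q⁺ (inj₁ (x∈⁅x⁆ i)) , x∈p∪q⁺ (inj₂ (x∈⁅x⁆ j))
        (inj₂ (refl , refl)) → x∈p∪q⁺ (inj₂ (x∈⁅x⁆ j)) , x∈p∪q⁺ (inj₁ (x∈⁅x⁆ i))
    where
    to : ∀ {i j u v : Fin n} → u ≡ i ⊎ u ≡ j → v ≡ i ⊎ v ≡ j → u ≢ v →
         (u ≡ i × v ≡ j) ⊎ (u ≡ j × v ≡ i)
    to (inj₁ p)    (inj₂ q)    _  = inj₁ (p , q)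
    to (inj₂ p)    (inj₁ q)    _  = inj₂ (p , q)
    to (inj₁ refl) (inj₁ refl) ne = contradiction refl ne
    to (inj₂ refl) (inj₂ refl) ne = contradiction refl ne

  edgeTriclique : (i j : Fin n) → i ≢ j → Triclique n
  edgeTriclique {n} i j i≢j = triclique ps disj
    where
    ps : Vec (Subset n) 3
    ps = ⁅ i ⁆ ∷ ⁅ j ⁆ ∷ ⊥ ∷ []

    apart : ∀ a b → a ≢ b → ∀ x → x ∈ lookup ps a → ¬ (x ∈ lookup ps b)
    apart zero             zero             ne _ _ _ = ne refl
    apart zero             (suc zero)       _  x p q =
      i≢j (trans (sym (x∈⁅y⁆⇒x≡y i p)) (x∈⁅y⁆⇒x≡y j q))
    apart (suc zero)       zero             _  x p q =
      i≢j (trans (sym (x∈⁅y⁆⇒x≡y i q)) (x∈⁅y⁆⇒x≡y j p))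
    apart (suc zero)       (suc zero)       ne _ _ _ = ne refl
    apart (suc (suc zero)) _                _  _ p _ = ∉⊥ p
    apart zero             (suc (suc zero)) _  _ _ q = ∉⊥ q
    apart (suc zero)       (suc (suc zero)) _  _ _ q = ∉⊥ q

    disj : ∀ a b → a ≢ b → Empty (lookup ps a ∩ lookup ps b)
    disj a b ne (x , x∈) with x∈p∩q⁻ (lookup ps a) (lookup ps b) x∈
    ... | p , q = apart a b ne x p q

  triclique-system : (G : Graph n) → ∃ λ k → Σ (Vec (Triclique n) k) (IsTricliqueSystem G)
  triclique-system = Cover.Existence.system tricliqueAdj?
    (λ _ (a , b , a≢b , p , q) → b , a , (λ e → a≢b (sym e)) , q , p)
    edgeTriclique
    λ i j i≢j u v _ → mk⇔ (to i≢j) λ where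
      (inj₁ (refl , refl)) → zero , suc zero , (λ ()) , x∈⁅x⁆ i , x∈⁅x⁆ j
      (inj₂ (refl , refl)) → suc zero , zero , (λ ()) , x∈⁅x⁆ j , x∈⁅x⁆ i
    where
    to : ∀ {i j u v : Fin n} (i≢j : i ≢ j) → TricliqueAdj (edgeTriclique i j i≢j) u v →
         (u ≡ i × v ≡ j) ⊎ (u ≡ j × v ≡ i)
    to _ (zero           , zero           , ne , _) = contradiction refl ne
    to _ (zero           , suc zero       , _ , p , q) = inj₁ (x∈⁅y⁆⇒x≡y _ p , x∈⁅y⁆⇒x≡y _ q)
    to _ (suc zero       , zero           , _ , p , q) = inj₂ (x∈⁅y⁆⇒x≡y _ p , x∈⁅y⁆⇒x≡y _ q)
    to _ (suc zero       , suc zero       , ne , _) = contradiction refl ne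
    to _ (suc (suc zero) , _              , _ , p , _) = contradiction p ∉⊥
    to _ (zero           , suc (suc zero) , _ , _ , q) = contradiction q ∉⊥
    to _ (suc zero       , suc (suc zero) , _ , _ , q) = contradiction q ∉⊥

  δ : Fin k → Fin k → 𝔽₂
  δ zero    zero    = 1ℙ
  δ zero    (suc _) = 0ℙ
  δ (suc _) zero    = 0ℙ
  δ (suc a) (suc b) = δ a b

  sum-δ : ∀ (a : Fin k) (f : Fin k → 𝔽₂) → sum (λ b → δ a b * f b) ≡ f a
  sum-δ {suc k} zero f =
    trans (cong (f zero +_) (sum-replicate-zero k)) (ℙ.+-identityʳ (f zero))
  sum-δ (suc a) f = sum-δ a (f ∘ suc)

  δ-refl : ∀ (a : Fin k) → δ a a ≡ 1ℙ
  δ-refl zero    = refl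
  δ-refl (suc a) = δ-refl a

  δ-≢ : ∀ {a b : Fin k} → a ≢ b → δ a b ≡ 0ℙ
  δ-≢ {a = zero}  {zero}  ne = contradiction refl ne
  δ-≢ {a = zero}  {suc b} ne = refl
  δ-≢ {a = suc a} {zero}  ne = refl
  δ-≢ {a = suc a} {suc b} ne = δ-≢ (ne ∘ cong suc)

  independent⇒≤ : ∀ (M : Matrix n) k → HasIndependentRows M k → k ≤ n
  independent⇒≤ M k (is , indep) = injective⇒≤ inj
    where
    rows = Vec.map (lookup M) is

    inj : ∀ {a b} → lookup is a ≡ lookup is b → a ≡ b
    inj {a} {b} eq with a ≟ b
    ... | yes a≡b = a≡b
    ... | no a≢b = contradiction c-a≡0 (subst (_≢ 0ℙ) (sym c-a≡1) λ ())
      where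
      c = tabulate (λ i → δ a i + δ b i)

      vanishes : ∀ j → sum (λ i → lookup c i * lookup (lookup rows i) j) ≡ 0ℙ
      vanishes j = begin
        sum (λ i → lookup c i * f i)
          ≡⟨ sum-cong-≗ (λ i → cong (_* f i) (lookup∘tabulate _ i)) ⟩
        sum (λ i → (δ a i + δ b i) * f i)
          ≡⟨ sum-cong-≗ (λ i → ℙ.*-distribʳ-+ (f i) (δ a i) (δ b i)) ⟩
        sum (λ i → (δ a i * f i) + (δ b i * f i))
          ≡⟨ ∑-distrib-+ (λ i → δ a i * f i) (λ i → δ b i * f i) ⟩
        sum (λ i → δ a i * f i) + sum (λ i → δ b i * f i)
          ≡⟨ cong₂ _+_ (sum-δ a f) (sum-δ b f) ⟩
        f a + f b
          ≡⟨ cong (f a +_) (sym fa≡fb) ⟩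
        f a + f a
          ≡⟨ ℙ.p+p≡0ℙ (f a) ⟩
        0ℙ ∎
        where
        open ≡-Reasoning
        f = λ i → lookup (lookup rows i) j
        fa≡fb : f a ≡ f b
        fa≡fb = cong (λ r → lookup r j) (begin
          lookup rows a         ≡⟨ lookup-map a (lookup M) is ⟩
          lookup M (lookup is a) ≡⟨ cong (lookup M) eq ⟩
          lookup M (lookup is b) ≡⟨ lookup-map b (lookup M) is ⟨
          lookup rows b         ∎)

      c-a≡0 : lookup c a ≡ 0ℙ
      c-a≡0 = indep c vanishes a

      c-a≡1 : lookup c a ≡ 1ℙ
      c-a≡1 = trans (lookup∘tabulate _ a) (cong₂ _+_ (δ-refl a) (δ-≢ (a≢b ∘ sym)))

  independentRows? : (M : Matrix n) → Decidable (HasIndependentRows M)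
  independentRows? M k = search-Vec any? k λ is →
    every? (search-Vec search-𝔽₂ k) λ c →
      all? (λ j → _ ℙ.≟ 0ℙ) →-dec all? (λ i → _ ℙ.≟ 0ℙ)

abstract

  rank-exists : (M : Matrix n) → ∃ (IsRank M)
  rank-exists M = maximum (independentRows? M) ([] , λ _ _ ()) _ (independent⇒≤ M)

rank : Matrix n → ℕ
rank M = proj₁ (rank-exists M)

IsMinimumRank : Graph n → ℕ → Set
IsMinimumRank {n} G = IsMinimum λ r →
  Σ (Matrix n) λ M → IsSymmetric M × Fits G M × rank M ≡ r

IsSubgraphComplementationNumber : Graph n → ℕ → Set
IsSubgraphComplementationNumber {n} G = IsMinimum λ k →
  Σ (Vec (Subset n) k) (IsSubgraphComplementationSystem G)

IsTricliqueNumber : Graph n → ℕ → Set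
IsTricliqueNumber {n} G = IsMinimum λ k →
  Σ (Vec (Triclique n) k) (IsTricliqueSystem G)

private

  adjacencyMatrix : (G : Graph n) →
    ∃ λ r → Σ (Matrix n) λ M → IsSymmetric M × Fits G M × rank M ≡ r
  adjacencyMatrix {n} G = _ , M , symmetric , fits , refl
    where
    entry : ∀ {A : Set} → Dec A → 𝔽₂
    entry (yes _) = 1ℙ
    entry (no _)  = 0ℙ

    M : Matrix n
    M = tabulate λ u → tabulate λ v → entry (adj? G u v)

    M-entry : ∀ u v → M ⟦ u , v ⟧ ≡ entry (adj? G u v)
    M-entry u v = trans (cong (λ r → lookup r v) (lookup∘tabulate _ u)) (lookup∘tabulate _ v)

    symmetric : IsSymmetric M
    symmetric u v rewrite M-entry u v | M-entry v u with adj? G u v | adj? G v u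
    ... | yes _ | yes _ = refl
    ... | no _  | no _  = refl
    ... | yes e | no ¬e = contradiction (symm G e) ¬e
    ... | no ¬e | yes e = contradiction (symm G e) ¬e

    fits : Fits G M
    fits u v _ rewrite M-entry u v with adj? G u v
    ... | yes e = mk⇔ (λ _ → e) (λ _ ())
    ... | no ¬e = mk⇔ (λ ne → contradiction refl ne) (λ e → contradiction e ¬e)

abstract

  mr-exists : (G : Graph n) → ∃ (IsMinimumRank G)
  mr-exists {n} G = minimum
    (λ r → search-Vec (search-Vec search-𝔽₂ n) n λ M →
      (all? λ u → all? λ v → M ⟦ u , v ⟧ ℙ.≟ M ⟦ v , u ⟧)
      ×-dec (all? λ u → all? λ v →
        ¬? (u ≟ v) →-dec (¬? (M ⟦ u , v ⟧ ℙ.≟ 0ℙ) ⇔-dec adj? G u v))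
      ×-dec rank M ℕ.≟ r)
    _ (proj₂ (adjacencyMatrix G))

  c₂-exists : (G : Graph n) → ∃ (IsSubgraphComplementationNumber G)
  c₂-exists G = minimum (Cover.system? cliqueAdj? anySubset? G)
    _ (proj₂ (clique-system G))

  t₂-exists : (G : Graph n) → ∃ (IsTricliqueNumber G)
  t₂-exists G = minimum (Cover.system? tricliqueAdj? search-Triclique G)
    _ (proj₂ (triclique-system G))

mr : Graph n → ℕ
mr G = proj₁ (mr-exists G)

c₂ : Graph n → ℕ
c₂ G = proj₁ (c₂-exists G)

t₂ : Graph n → ℕ
t₂ G = proj₁ (t₂-exists G)

{-# OPTIONS --safe #-}
module Submission where

-- A sum of m dyads a bᵀ has rank at most m.  A subgraph complementation system
-- is a sum of squares s sᵀ, and a triclique with parts X, Y, Z is the hyperbolic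
-- form a bᵀ + b aᵀ with a = χ_X + χ_Z and b = χ_Y + χ_Z, so mr is at most both
-- c₂ and 2 t₂.  Conversely, symmetric elimination writes a symmetric matrix of
-- rank at most b as at most b squares, pivoting on a nonzero diagonal entry, or,
-- if its diagonal is zero, as at most b / 2 hyperbolic forms, pivoting on an
-- off-diagonal pair.  When hyperbolic forms remain after a diagonal pivot c cᵀ,
-- each of them merges with a square into three squares.

open import Defs
open import Data.Nat.Base using (ℕ; _*_; _⊓_)
open import Relation.Binary.PropositionalEquality using (_≡_)

import Algebra.Properties.Semiring.Sum as Sum
import Algebra.Solver.Ring.AlmostCommutativeRing as ACR
import Algebra.Solver.Ring.Simple as RingSolver
open import Data.Bool.Base using (if_then_else_)
open import Data.Empty using (⊥-elim-irr)
open import Data.Fin.Base using (Fin; zero; suc; combine; funToFin; finToFun)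
open import Data.Fin.Properties using (_≟_; all?; any?; injective⇒≤; funToFin-finToFin; finToFun-funToFin)
open import Data.Fin.Subset using (Subset; _∈_; _∉_; _∩_; Empty)
open import Data.Fin.Subset.Properties using (_∈?_; x∈p∩q⁺; x∈p∩q⁻)
open import Data.Nat.Base using (zero; suc; _+_; _^_; _≤_; z≤n; s≤s; s≤s⁻¹; parity)
import Data.Nat.Properties as ℕ
open import Data.Parity.Base using (0ℙ; 1ℙ) renaming (_+_ to infixl 6 _⊕_; _*_ to infixl 7 _⊗_)
import Data.Parity.Properties as ℙ
open import Data.Product.Base using (Σ; ∃; _×_; _,_; proj₁; proj₂)
open import Data.Sum.Base using (_⊎_; inj₁; inj₂)
open import Data.Vec.Base using (Vec; []; _∷_; lookup; tabulate; map; concat; count)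
open import Data.Vec.Properties using (lookup∘tabulate; lookup-map; lookup⇒[]=; []=⇒lookup)
open import Function.Base using (_∘_)
open import Function.Bundles using (_⇔_; mk⇔; module Equivalence)
open import Relation.Binary.PropositionalEquality
  using (_≢_; _≗_; refl; sym; trans; cong; cong₂; subst; module ≡-Reasoning)
open import Relation.Nullary using (¬_; Dec; yes; no; does; contradiction)
open import Relation.Nullary.Decidable using (¬?; decidable-stable; dec-true; from-yes; _→-dec_)
open import Relation.Unary using (Decidable)

open Graph using (Adj)
open Equivalence using (to; from)
open Sum ℙ.+-*-semiring using (sum; sum-cong-≗; sum-replicate-zero; ∑-distrib-+; ∑-comm; *-distribˡ-sum; *-distribʳ-sum)
open RingSolver (ACR.fromCommutativeRing ℙ.+-*-commutativeRing) ℙ._≟_ using (solve; con; _:=_; _:+_; _:*_)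

private
  variable
    n k m : ℕ

-- Arithmetic of the two-element field.

≢0⇒≡1 : ∀ {p} → p ≢ 0ℙ → p ≡ 1ℙ
≢0⇒≡1 {0ℙ} p≢0 = contradiction refl p≢0
≢0⇒≡1 {1ℙ} _   = refl

≢1⇒≡0 : ∀ {p} → p ≢ 1ℙ → p ≡ 0ℙ
≢1⇒≡0 {0ℙ} _   = refl
≢1⇒≡0 {1ℙ} p≢1 = contradiction refl p≢1

p+q≡0⇒p≡q : ∀ p q → p ⊕ q ≡ 0ℙ → p ≡ q
p+q≡0⇒p≡q p q e = ℙ.+-cancelʳ-≡ q p q (trans e (sym (ℙ.p+p≡0ℙ q)))

sum-zero : (f : Fin k → 𝔽₂) → (∀ i → f i ≡ 0ℙ) → sum f ≡ 0ℙ
sum-zero {k} f f≡0 = trans (sum-cong-≗ f≡0) (sum-replicate-zero k)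

-- Forms and their independent rows.

Vector : ℕ → Set
Vector n = Fin n → 𝔽₂

-- Matrices as functions: the eliminated forms then unfold by computation, with no `tabulate` to
-- look through.
Form : ℕ → Set
Form n = Fin n → Fin n → 𝔽₂

combination : Form n → Vec (Fin n) k → Vec 𝔽₂ k → Fin n → 𝔽₂
combination F is c j = sum (λ i → lookup c i ⊗ F (lookup is i) j)

IndependentRows : Form n → ℕ → Set
IndependentRows {n} F k = Σ (Vec (Fin n) k) λ is →
  ∀ c → (∀ j → combination F is c j ≡ 0ℙ) → ∀ i → lookup c i ≡ 0ℙ

-- An upper bound is all that the induction carries along, so the rank of an intermediate form is
-- never computed.
RankAtMost : ℕ → Form n → Set
RankAtMost b F = ∀ k → IndependentRows F k → k ≤ b

combination-cong : {F F′ : Form n} → (∀ u v → F u v ≡ F′ u v) →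
  ∀ (is : Vec (Fin n) k) c j → combination F is c j ≡ combination F′ is c j
combination-cong F≡F′ is c j = sum-cong-≗ λ i → cong (lookup c i ⊗_) (F≡F′ _ _)

independentRows-cong : {F F′ : Form n} → (∀ u v → F u v ≡ F′ u v) →
  IndependentRows F k → IndependentRows F′ k
independentRows-cong F≡F′ (is , indep) = is , λ c c≡0 →
  indep c (λ j → trans (combination-cong F≡F′ is c j) (c≡0 j))

row-entry : (M : Matrix n) (is : Vec (Fin n) k) → ∀ i j →
  lookup (lookup (map (lookup M) is) i) j ≡ M ⟦ lookup is i , j ⟧
row-entry M is i j = cong (λ r → lookup r j) (lookup-map i (lookup M) is)

rows-combination : (M : Matrix n) (is : Vec (Fin n) k) → ∀ c j →
  sum (λ i → lookup c i ⊗ lookup (lookup (map (lookup M) is) i) j) ≡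
  combination (M ⟦_,_⟧) is c j
rows-combination M is c j = sum-cong-≗ λ i → cong (lookup c i ⊗_) (row-entry M is i j)

hasIndependentRows⁺ : (M : Matrix n) → IndependentRows (M ⟦_,_⟧) k → HasIndependentRows M k
hasIndependentRows⁺ M (is , indep) = is , λ c c≡0 →
  indep c (λ j → trans (sym (rows-combination M is c j)) (c≡0 j))

hasIndependentRows⁻ : (M : Matrix n) → HasIndependentRows M k → IndependentRows (M ⟦_,_⟧) k
hasIndependentRows⁻ M (is , indep) = is , λ c c≡0 →
  indep c (λ j → trans (rows-combination M is c j) (c≡0 j))

-- Elimination and the rank it costs.

eliminate : Form n → Fin n → Fin n → Form n
eliminate F u w i j = F i j ⊕ F i w ⊗ F u j

-- The pivot row `u` extends any family that is independent after elimination: column `w` of a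
-- relation forces its coefficient `c₀` to be `S w`, and substituting this turns the relation into
-- one among the eliminated rows. Hence each pivot lowers a rank bound by one.
eliminate-independent : (F : Form n) → ∀ u w → F u w ≡ 1ℙ →
  IndependentRows (eliminate F u w) k → IndependentRows F (suc k)
eliminate-independent {n} F u w Fuw≡1 (is , indep) = u ∷ is , independent
  where
  independent : ∀ c → (∀ j → combination F (u ∷ is) c j ≡ 0ℙ) → ∀ i → lookup c i ≡ 0ℙ
  independent (c₀ ∷ c) c≡0 = λ { zero → c₀≡0 ; (suc i) → tail≡0 i }
    where
    open ≡-Reasoning
    S = combination F is c

    c₀≡Sw : c₀ ≡ S w
    c₀≡Sw = p+q≡0⇒p≡q c₀ (S w) (begin
      c₀ ⊕ S w          ≡⟨ cong (_⊕ S w) (ℙ.*-identityʳ c₀) ⟨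
      c₀ ⊗ 1ℙ ⊕ S w     ≡⟨ cong (λ p → c₀ ⊗ p ⊕ S w) Fuw≡1 ⟨
      c₀ ⊗ F u w ⊕ S w  ≡⟨ c≡0 w ⟩
      0ℙ                ∎)

    tail≡0 : ∀ i → lookup c i ≡ 0ℙ
    tail≡0 = indep c λ j → begin
      combination (eliminate F u w) is c j
        ≡⟨ sum-cong-≗ (λ i → solve 4 (λ a x y z → a :* (x :+ y :* z) := a :* x :+ (a :* y) :* z)
             refl (lookup c i) (F (lookup is i) j) (F (lookup is i) w) (F u j)) ⟩
      sum (λ i → lookup c i ⊗ F (lookup is i) j ⊕ lookup c i ⊗ F (lookup is i) w ⊗ F u j)
        ≡⟨ ∑-distrib-+ (λ i → lookup c i ⊗ F (lookup is i) j) _ ⟩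
      S j ⊕ sum (λ i → lookup c i ⊗ F (lookup is i) w ⊗ F u j)
        ≡⟨ cong (S j ⊕_) (*-distribʳ-sum (F u j) (λ i → lookup c i ⊗ F (lookup is i) w)) ⟨
      S j ⊕ S w ⊗ F u j
        ≡⟨ cong (λ p → S j ⊕ p ⊗ F u j) c₀≡Sw ⟨
      S j ⊕ c₀ ⊗ F u j
        ≡⟨ ℙ.+-comm (S j) _ ⟩
      c₀ ⊗ F u j ⊕ S j
        ≡⟨ c≡0 j ⟩
      0ℙ ∎

    c₀≡0 : c₀ ≡ 0ℙ
    c₀≡0 = trans c₀≡Sw (sum-zero _ λ i → cong (_⊗ F (lookup is i) w) (tail≡0 i))

-- The rank of a sum of dyads, by counting.

funToFin-cong : {f g : Fin k → Fin m} → f ≗ g → funToFin f ≡ funToFin g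
funToFin-cong {zero}  f≗g = refl
funToFin-cong {suc k} f≗g = cong₂ combine (f≗g zero) (funToFin-cong (f≗g ∘ suc))

toBit : 𝔽₂ → Fin 2
toBit 0ℙ = zero
toBit 1ℙ = suc zero

fromBit : Fin 2 → 𝔽₂
fromBit zero       = 0ℙ
fromBit (suc zero) = 1ℙ

toBit-injective : ∀ {p q} → toBit p ≡ toBit q → p ≡ q
toBit-injective {0ℙ} {0ℙ} _ = refl
toBit-injective {1ℙ} {1ℙ} _ = refl

fromBit-injective : ∀ {x y} → fromBit x ≡ fromBit y → x ≡ y
fromBit-injective {zero}     {zero}     _ = refl
fromBit-injective {zero}     {suc zero} ()
fromBit-injective {suc zero} {zero}     ()
fromBit-injective {suc zero} {suc zero} _ = refl

2^-cancel-≤ : 2 ^ k ≤ 2 ^ m → k ≤ m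
2^-cancel-≤ 2^k≤2^m = ℕ.≮⇒≥ λ m<k → ℕ.<⇒≱ (ℕ.^-monoʳ-< 2 (s≤s (s≤s z≤n)) m<k) 2^k≤2^m

-- The 2^k vectors c have distinct images among 2^m.
injective-coordinates⇒≤ : (φ : Vec 𝔽₂ k → Fin m → 𝔽₂) →
  (∀ c d → φ c ≗ φ d → lookup c ≗ lookup d) → k ≤ m
injective-coordinates⇒≤ {k} {m} φ φ-inj = 2^-cancel-≤ (injective⇒≤ {f = code} code-injective)
  where
  vector : Fin (2 ^ k) → Vec 𝔽₂ k
  vector x = tabulate (fromBit ∘ finToFun {2} {k} x)

  code : Fin (2 ^ k) → Fin (2 ^ m)
  code x = funToFin (toBit ∘ φ (vector x))

  code-injective : ∀ {x y} → code x ≡ code y → x ≡ y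
  code-injective {x} {y} eq = trans (sym (funToFin-finToFin {k} x))
    (trans (funToFin-cong bits≡) (funToFin-finToFin {k} y))
    where
    φ≡ : φ (vector x) ≗ φ (vector y)
    φ≡ i = toBit-injective (trans (sym (finToFun-funToFin (toBit ∘ φ (vector x)) i))
      (trans (cong (λ z → finToFun z i) eq) (finToFun-funToFin (toBit ∘ φ (vector y)) i)))

    bits≡ : finToFun {2} {k} x ≗ finToFun y
    bits≡ i = fromBit-injective (trans (sym (lookup∘tabulate _ i))
      (trans (φ-inj (vector x) (vector y) φ≡ i) (lookup∘tabulate _ i)))

dyads : Vec (Vector n × Vector n) m → Form n
dyads ps u v = sum (λ l → proj₁ (lookup ps l) u ⊗ proj₂ (lookup ps l) v)

-- A combination of rows depends on its coefficients `c` only through the `m` numbers `φ c l`. If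
-- `φ c` and `φ d` agree, then `c + d` is a relation among the chosen rows, so independence gives
-- `c = d`, and the counting bound applies.
dyads-rank : (ps : Vec (Vector n × Vector n) m) → RankAtMost m (dyads ps)
dyads-rank {n} {m} ps k (is , indep) = injective-coordinates⇒≤ φ φ-inj
  where
  open ≡-Reasoning
  a b : Fin m → Fin n → 𝔽₂
  a l = proj₁ (lookup ps l)
  b l = proj₂ (lookup ps l)

  φ : Vec 𝔽₂ k → Fin m → 𝔽₂
  φ c l = sum (λ i → lookup c i ⊗ a l (lookup is i))

  combination-φ : ∀ c j → combination (dyads ps) is c j ≡ sum (λ l → φ c l ⊗ b l j)
  combination-φ c j = begin
    combination (dyads ps) is c j
      ≡⟨ sum-cong-≗ (λ i → *-distribˡ-sum (lookup c i) (λ l → a l (lookup is i) ⊗ b l j)) ⟩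
    sum (λ i → sum (λ l → lookup c i ⊗ (a l (lookup is i) ⊗ b l j)))
      ≡⟨ ∑-comm (λ i l → lookup c i ⊗ (a l (lookup is i) ⊗ b l j)) ⟩
    sum (λ l → sum (λ i → lookup c i ⊗ (a l (lookup is i) ⊗ b l j)))
      ≡⟨ sum-cong-≗ (λ l → sum-cong-≗ λ i → ℙ.*-assoc (lookup c i) (a l (lookup is i)) (b l j)) ⟨
    sum (λ l → sum (λ i → lookup c i ⊗ a l (lookup is i) ⊗ b l j))
      ≡⟨ sum-cong-≗ (λ l → *-distribʳ-sum (b l j) (λ i → lookup c i ⊗ a l (lookup is i))) ⟨
    sum (λ l → φ c l ⊗ b l j) ∎

  φ-inj : ∀ c d → φ c ≗ φ d → lookup c ≗ lookup d
  φ-inj c d φc≗φd i = p+q≡0⇒p≡q _ _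
    (trans (sym (lookup∘tabulate _ i)) (indep e vanishes i))
    where
    e = tabulate (λ i → lookup c i ⊕ lookup d i)

    vanishes : ∀ j → combination (dyads ps) is e j ≡ 0ℙ
    vanishes j = begin
      combination (dyads ps) is e j
        ≡⟨ sum-cong-≗ (λ i → trans (cong (_⊗ x i) (lookup∘tabulate _ i))
             (ℙ.*-distribʳ-+ (x i) (lookup c i) (lookup d i))) ⟩
      sum (λ i → lookup c i ⊗ x i ⊕ lookup d i ⊗ x i)
        ≡⟨ ∑-distrib-+ (λ i → lookup c i ⊗ x i) _ ⟩
      combination (dyads ps) is c j ⊕ combination (dyads ps) is d j
        ≡⟨ cong₂ _⊕_ (combination-φ c j) (combination-φ d j) ⟩
      sum (λ l → φ c l ⊗ b l j) ⊕ sum (λ l → φ d l ⊗ b l j)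
        ≡⟨ cong (_⊕ sum (λ l → φ d l ⊗ b l j)) (sum-cong-≗ λ l → cong (_⊗ b l j) (φc≗φd l)) ⟩
      sum (λ l → φ d l ⊗ b l j) ⊕ sum (λ l → φ d l ⊗ b l j)
        ≡⟨ ℙ.p+p≡0ℙ (sum (λ l → φ d l ⊗ b l j)) ⟩
      0ℙ ∎
      where
      x = λ i → dyads ps (lookup is i) j

-- Squares, hyperbolic forms and the decomposition of symmetric forms.

squares : Vec (Vector n) k → Form n
squares ss = dyads (map (λ s → s , s) ss)

-- Each hyperbolic form is spelled out as two dyads, so that `dyads-rank` yields the factor 2
-- directly.
hyperbolicPairs : Vec (Vector n × Vector n) k → Vec (Vector n × Vector n) (k * 2)
hyperbolicPairs hs = concat (map (λ (a , b) → (a , b) ∷ (b , a) ∷ []) hs)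

hyperbolics : Vec (Vector n × Vector n) k → Form n
hyperbolics hs = dyads (hyperbolicPairs hs)

squares-sym : (ss : Vec (Vector n) k) → ∀ u v → squares ss u v ≡ squares ss v u
squares-sym []       u v = refl
squares-sym (s ∷ ss) u v = cong₂ _⊕_ (ℙ.*-comm (s u) (s v)) (squares-sym ss u v)

hyperbolics-sym : (hs : Vec (Vector n × Vector n) k) →
  ∀ u v → hyperbolics hs u v ≡ hyperbolics hs v u
hyperbolics-sym []             u v = refl
hyperbolics-sym ((a , b) ∷ hs) u v = trans
  (cong (λ p → a u ⊗ b v ⊕ (b u ⊗ a v ⊕ p)) (hyperbolics-sym hs u v))
  (solve 5 (λ p q r s x → p :* q :+ (r :* s :+ x) := s :* r :+ (q :* p :+ x))
    refl (a u) (b v) (b u) (a v) (hyperbolics hs v u))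

IsSquareSum : ℕ → Form n → Set
IsSquareSum {n} k F = Σ (Vec (Vector n) k) λ ss → ∀ u v → F u v ≡ squares ss u v

IsHyperbolicSum : ℕ → Form n → Set
IsHyperbolicSum {n} t F = Σ (Vec (Vector n × Vector n) t) λ hs →
  ∀ u v → F u v ≡ hyperbolics hs u v

-- c² + ab + ba = (a + c)² + (b + c)² + (a + b + c)².
absorb-hyperbolics : (ss : Vec (Vector n) (suc k)) (hs : Vec (Vector n × Vector n) m) →
  IsSquareSum (suc (m * 2 + k)) (λ u v → squares ss u v ⊕ hyperbolics hs u v)
absorb-hyperbolics ss [] = ss , λ u v → ℙ.+-identityʳ (squares ss u v)
absorb-hyperbolics ss ((a , b) ∷ hs) with absorb-hyperbolics ss hs
... | c ∷ cs , eq =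
  -- The square of `c` is traded for three, and the new head `a + c` is available to absorb the next
  -- form.
  (λ u → a u ⊕ c u) ∷ (λ u → b u ⊕ c u) ∷ (λ u → a u ⊕ b u ⊕ c u) ∷ cs , λ u v → begin
    squares ss u v ⊕ (a u ⊗ b v ⊕ (b u ⊗ a v ⊕ hyperbolics hs u v))
      ≡⟨ solve 6 (λ s p q r t h → s :+ (p :* q :+ (r :* t :+ h)) := (s :+ h) :+ (p :* q :+ r :* t))
           refl (squares ss u v) (a u) (b v) (b u) (a v) (hyperbolics hs u v) ⟩
    squares ss u v ⊕ hyperbolics hs u v ⊕ (a u ⊗ b v ⊕ b u ⊗ a v)
      ≡⟨ cong (_⊕ (a u ⊗ b v ⊕ b u ⊗ a v)) (eq u v) ⟩
    c u ⊗ c v ⊕ squares cs u v ⊕ (a u ⊗ b v ⊕ b u ⊗ a v)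
      ≡⟨ solve 7 (λ x x′ y y′ z z′ s →
           (z :* z′ :+ s) :+ (x :* y′ :+ y :* x′) :=
           (x :+ z) :* (x′ :+ z′) :+ ((y :+ z) :* (y′ :+ z′) :+ ((x :+ y :+ z) :* (x′ :+ y′ :+ z′) :+ s)))
           refl (a u) (a v) (b u) (b v) (c u) (c v) (squares cs u v) ⟩
    _ ∎
  where open ≡-Reasoning

-- An entry `F u v ≡ 1ℙ` gives two pivots, `(u , v)` and then `(v , u)`. Together they subtract one
-- hyperbolic form, built from column `v` and row `u`, and leave an alternating form whose rank
-- bound is smaller by two.
alternating-decomposition : ∀ b (F : Form n) → (∀ u v → F u v ≡ F v u) → (∀ u → F u u ≡ 0ℙ) →
  RankAtMost b F → ∃ λ t → t * 2 ≤ b × IsHyperbolicSum t F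
alternating-decomposition {n} b F F-sym F-alt rank≤b
  with any? (λ u → any? λ v → F u v ℙ.≟ 1ℙ)
... | no F≢1 = 0 , z≤n , [] , λ u v → ≢1⇒≡0 λ e → F≢1 (u , v , e)
... | yes (u , v , Fuv≡1) = reduce b rank≤b
  where
  open ≡-Reasoning
  -- `F′` need not be symmetric; the second pivot restores symmetry, so the induction continues with
  -- `F″` only.
  F′ F″ : Form n
  F′ = eliminate F u v
  F″ i j = F i j ⊕ (F i v ⊗ F u j ⊕ F i u ⊗ F v j)

  Fvu≡1 : F v u ≡ 1ℙ
  Fvu≡1 = trans (F-sym v u) Fuv≡1

  -- The row v and the column u of F are unaffected by the first elimination.
  F′vj : ∀ j → F′ v j ≡ F v j
  F′vj j = trans (cong (λ p → F v j ⊕ p ⊗ F u j) (F-alt v)) (ℙ.+-identityʳ (F v j))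

  F′iu : ∀ i → F′ i u ≡ F i u
  F′iu i = begin
    F i u ⊕ F i v ⊗ F u u  ≡⟨ cong (λ p → F i u ⊕ F i v ⊗ p) (F-alt u) ⟩
    F i u ⊕ F i v ⊗ 0ℙ     ≡⟨ cong (F i u ⊕_) (ℙ.*-zeroʳ (F i v)) ⟩
    F i u ⊕ 0ℙ             ≡⟨ ℙ.+-identityʳ (F i u) ⟩
    F i u                  ∎

  F″≡ : ∀ i j → F″ i j ≡ eliminate F′ v u i j
  F″≡ i j = trans (sym (ℙ.+-assoc (F i j) (F i v ⊗ F u j) (F i u ⊗ F v j)))
    (sym (cong₂ (λ p q → F′ i j ⊕ p ⊗ q) (F′iu i) (F′vj j)))

  lift : ∀ {k} → IndependentRows F″ k → IndependentRows F (suc (suc k))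
  lift = eliminate-independent F u v Fuv≡1
    ∘ eliminate-independent F′ v u (trans (F′vj u) Fvu≡1)
    ∘ independentRows-cong F″≡

  F″-sym : ∀ i j → F″ i j ≡ F″ j i
  F″-sym i j = cong₂ _⊕_ (F-sym i j) (begin
    F i v ⊗ F u j ⊕ F i u ⊗ F v j
      ≡⟨ cong₂ _⊕_ (cong₂ _⊗_ (F-sym i v) (F-sym u j)) (cong₂ _⊗_ (F-sym i u) (F-sym v j)) ⟩
    F v i ⊗ F j u ⊕ F u i ⊗ F j v
      ≡⟨ solve 4 (λ p q r s → p :* q :+ r :* s := s :* r :+ q :* p) refl (F v i) (F j u) (F u i) (F j v) ⟩
    F j v ⊗ F u i ⊕ F j u ⊗ F v i ∎)

  F″-alt : ∀ i → F″ i i ≡ 0ℙ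
  F″-alt i = begin
    F i i ⊕ (F i v ⊗ F u i ⊕ F i u ⊗ F v i)
      ≡⟨ cong₂ _⊕_ (F-alt i) (cong₂ (λ p q → F i v ⊗ p ⊕ F i u ⊗ q) (F-sym u i) (F-sym v i)) ⟩
    F i v ⊗ F i u ⊕ F i u ⊗ F i v
      ≡⟨ solve 2 (λ p q → p :* q :+ q :* p := con 0ℙ) refl (F i v) (F i u) ⟩
    0ℙ ∎

  reduce : ∀ b → RankAtMost b F → ∃ λ t → t * 2 ≤ b × IsHyperbolicSum t F
  reduce (suc (suc b)) rank≤b =
    let t , 2t≤b , hs , eq = alternating-decomposition b F″ F″-sym F″-alt
          (λ k ind → s≤s⁻¹ (s≤s⁻¹ (rank≤b (suc (suc k)) (lift ind))))
    in suc t , s≤s (s≤s 2t≤b) , ((λ i → F i v) , F u) ∷ hs , λ i j → begin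
      F i j
        ≡⟨ solve 3 (λ x p q → x := p :+ (q :+ (x :+ (p :+ q)))) refl
             (F i j) (F i v ⊗ F u j) (F i u ⊗ F v j) ⟩
      F i v ⊗ F u j ⊕ (F i u ⊗ F v j ⊕ F″ i j)
        ≡⟨ cong (F i v ⊗ F u j ⊕_) (cong₂ _⊕_ (cong₂ _⊗_ (F-sym i u) (F-sym v j)) (eq i j)) ⟩
      F i v ⊗ F u j ⊕ (F u i ⊗ F j v ⊕ hyperbolics hs i j) ∎
  -- Lifting the empty family shows that the two pivot rows are independent, so a bound below 2 is
  -- impossible.
  reduce 0 rank≤b = contradiction (rank≤b 2 (lift ([] , λ _ _ ()))) λ ()
  reduce 1 rank≤b = contradiction (rank≤b 2 (lift ([] , λ _ _ ()))) λ { (s≤s ()) }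

-- A diagonal pivot at `u` splits off the square of row `u` and lowers the bound by one. The
-- remainder is again symmetric, but may be alternating even though `F` is not; the pivot square
-- then absorbs its hyperbolic forms, so a nonzero diagonal always leads to squares.
symmetric-decomposition : ∀ b (F : Form n) → (∀ u v → F u v ≡ F v u) → RankAtMost b F →
  (∃ λ k → k ≤ b × IsSquareSum k F) ⊎ (∃ λ t → t * 2 ≤ b × IsHyperbolicSum t F)
symmetric-decomposition b F F-sym rank≤b with any? (λ u → F u u ℙ.≟ 1ℙ)
... | no F≢1 = inj₂ (alternating-decomposition b F F-sym (λ u → ≢1⇒≡0 λ e → F≢1 (u , e)) rank≤b)
... | yes (u , Fuu≡1) = inj₁ (reduce b rank≤b)
  where
  open ≡-Reasoning
  F′ : Form _
  F′ = eliminate F u u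

  F′-sym : ∀ i j → F′ i j ≡ F′ j i
  F′-sym i j = cong₂ _⊕_ (F-sym i j)
    (trans (ℙ.*-comm (F i u) (F u j)) (cong₂ _⊗_ (F-sym u j) (F-sym i u)))

  F≡ : ∀ i j → F i j ≡ F u i ⊗ F u j ⊕ F′ i j
  F≡ i j = begin
    F i j                              ≡⟨ solve 2 (λ x y → x := y :+ (x :+ y)) refl (F i j) (F i u ⊗ F u j) ⟩
    F i u ⊗ F u j ⊕ F′ i j             ≡⟨ cong (λ p → p ⊗ F u j ⊕ F′ i j) (F-sym i u) ⟩
    F u i ⊗ F u j ⊕ F′ i j             ∎

  reduce : ∀ b → RankAtMost b F → ∃ λ k → k ≤ b × IsSquareSum k F
  reduce zero rank≤b =
    contradiction (rank≤b 1 (eliminate-independent F u u Fuu≡1 ([] , λ _ _ ()))) λ ()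
  reduce (suc b) rank≤b with symmetric-decomposition b F′ F′-sym
    (λ k ind → s≤s⁻¹ (rank≤b (suc k) (eliminate-independent F u u Fuu≡1 ind)))
  ... | inj₁ (k , k≤b , ss , eq) =
    suc k , s≤s k≤b , F u ∷ ss , λ i j → trans (F≡ i j) (cong (F u i ⊗ F u j ⊕_) (eq i j))
  ... | inj₂ (t , 2t≤b , hs , eq) =
    -- One square and `t` hyperbolic forms become `2t + 1` squares, which fits since `2t` is at most
    -- the lowered bound. The summand 0 counts the squares beside the pivot's.
    let ss , eq′ = absorb-hyperbolics (F u ∷ []) hs
    in suc (t * 2 + 0) , s≤s (subst (_≤ b) (sym (ℕ.+-identityʳ (t * 2))) 2t≤b) , ss , λ i j → begin
      F i j                                         ≡⟨ F≡ i j ⟩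
      F u i ⊗ F u j ⊕ F′ i j                        ≡⟨ cong₂ _⊕_ (sym (ℙ.+-identityʳ (F u i ⊗ F u j))) (eq i j) ⟩
      F u i ⊗ F u j ⊕ 0ℙ ⊕ hyperbolics hs i j       ≡⟨ eq′ i j ⟩
      squares ss i j                                ∎

-- Indicators, and cliques as squares.

𝟙 : {A : Set} → Dec A → 𝔽₂
𝟙 a? = if does a? then 1ℙ else 0ℙ

𝟙-unique : {A : Set} {p : 𝔽₂} (a? : Dec A) → (A → p ≡ 1ℙ) → (p ≡ 1ℙ → A) → 𝟙 a? ≡ p
𝟙-unique (yes a) f g = sym (f a)
𝟙-unique (no ¬a) f g = sym (≢1⇒≡0 (¬a ∘ g))

𝟙-true : {A : Set} (a? : Dec A) → 𝟙 a? ≡ 1ℙ → A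
𝟙-true (yes a) _ = a

𝟙-cong : {A B : Set} (a? : Dec A) (b? : Dec B) → (A → B) → (B → A) → 𝟙 a? ≡ 𝟙 b?
𝟙-cong a? b? f g = 𝟙-unique a? (λ a → cong (if_then 1ℙ else 0ℙ) (dec-true b? (f a))) (g ∘ 𝟙-true b?)

𝟙-false : {A : Set} (a? : Dec A) → ¬ A → 𝟙 a? ≡ 0ℙ
𝟙-false a? ¬a = 𝟙-unique a? (λ a → contradiction a ¬a) (λ ())

parity-count : {A : Set} {P : A → Set} (P? : Decidable P) (x : A) (xs : Vec A k) →
  parity (count P? (x ∷ xs)) ≡ 𝟙 (P? x) ⊕ parity (count P? xs)
parity-count P? x xs with P? x
... | yes _ = ℙ.+-homo-+ 1 (count P? xs)
... | no  _ = refl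

χ : Subset n → Fin n → 𝔽₂
χ S u = 𝟙 (u ∈? S)

support : Vector n → Subset n
support f = tabulate λ u → does (f u ℙ.≟ 1ℙ)

∈-support⁻ : (f : Vector n) → ∀ {u} → u ∈ support f → f u ≡ 1ℙ
∈-support⁻ f {u} u∈ = 𝟙-true (f u ℙ.≟ 1ℙ)
  (cong (if_then 1ℙ else 0ℙ) (trans (sym (lookup∘tabulate _ u)) ([]=⇒lookup u∈)))

∈-support⁺ : (f : Vector n) → ∀ {u} → f u ≡ 1ℙ → u ∈ support f
∈-support⁺ f {u} fu≡1 =
  lookup⇒[]= u _ (trans (lookup∘tabulate _ u) (dec-true (f u ℙ.≟ 1ℙ) fu≡1))

χ-support : (f : Vector n) → ∀ u → χ (support f) u ≡ f u
χ-support f u = 𝟙-unique (u ∈? support f) (∈-support⁻ f) (∈-support⁺ f)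

-- A set contains both `u` and `v` exactly when the product of its indicator values there is 1, and
-- the parity of a count is the sum of the indicators of what is counted.
parity-cliques : (𝒞 : Vec (Subset n) k) → ∀ u v →
  parity (count (cliqueAdj? u v) 𝒞) ≡ squares (map χ 𝒞) u v
parity-cliques []      u v = refl
parity-cliques (S ∷ 𝒞) u v =
  trans (parity-count (cliqueAdj? u v) S 𝒞) (cong₂ _⊕_ block (parity-cliques 𝒞 u v))
  where
  block : 𝟙 (cliqueAdj? u v S) ≡ χ S u ⊗ χ S v
  block with u ∈? S | v ∈? S
  ... | yes _ | yes _ = refl
  ... | yes _ | no  _ = refl
  ... | no  _ | yes _ = refl
  ... | no  _ | no  _ = refl

squares-support : (ss : Vec (Vector n) k) → ∀ u v →
  squares (map χ (map support ss)) u v ≡ squares ss u v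
squares-support []       u v = refl
squares-support (s ∷ ss) u v =
  cong₂ _⊕_ (cong₂ _⊗_ (χ-support s u) (χ-support s v)) (squares-support ss u v)

-- Tricliques as hyperbolic forms.

coordinates : Triclique n → Vector n × Vector n
coordinates T = (λ u → χ (part zero) u ⊕ χ (part (suc (suc zero))) u)
              , (λ u → χ (part (suc zero)) u ⊕ χ (part (suc (suc zero))) u)
  where part = lookup (parts T)

locate : (T : Triclique n) → ∀ u →
  (∀ i → u ∉ lookup (parts T) i) ⊎
  (∃ λ i → u ∈ lookup (parts T) i × ∀ j → u ∈ lookup (parts T) j → j ≡ i)
locate (triclique ps disjoint) u with any? (λ i → u ∈? lookup ps i)
... | no u∉ = inj₁ λ i u∈ → u∉ (i , u∈)
-- Disjointness is an irrelevant field, so it may only refute: the equality is reached by double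
-- negation.
... | yes (i , u∈i) = inj₂ (i , u∈i , λ j u∈j → decidable-stable (j ≟ i) λ j≢i →
  ⊥-elim-irr (disjoint j i j≢i (u , x∈p∩q⁺ (u∈j , u∈i))))

-- X, Y, Z have coordinates (1,0), (0,1), (1,1), and the nonzero alternating
-- form on 𝔽₂² is 1 exactly on pairs of distinct nonzero vectors.
triclique-hyperbolic : (T : Triclique n) → ∀ u v → let a , b = coordinates T in
  𝟙 (tricliqueAdj? u v T) ≡ a u ⊗ b v ⊕ b u ⊗ a v
triclique-hyperbolic T u v with locate T u | locate T v
... | inj₁ u∉ | _ = trans
  (𝟙-false (tricliqueAdj? u v T) λ (i , _ , _ , u∈ , _) → u∉ i u∈)
  (sym (cong₂ (λ p q → p ⊗ _ ⊕ q ⊗ _) (cong₂ _⊕_ (out _) (out _)) (cong₂ _⊕_ (out _) (out _))))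
  where
  out : ∀ i → χ (lookup (parts T) i) u ≡ 0ℙ
  out i = 𝟙-false (u ∈? lookup (parts T) i) (u∉ i)
... | inj₂ _ | inj₁ v∉ = trans
  (𝟙-false (tricliqueAdj? u v T) λ (_ , j , _ , _ , v∈) → v∉ j v∈)
  (sym (trans (cong₂ (λ p q → a u ⊗ p ⊕ b u ⊗ q) (cong₂ _⊕_ (out _) (out _)) (cong₂ _⊕_ (out _) (out _)))
    (cong₂ _⊕_ (ℙ.*-zeroʳ (a u)) (ℙ.*-zeroʳ (b u)))))
  where
  a = proj₁ (coordinates T)
  b = proj₂ (coordinates T)
  out : ∀ i → χ (lookup (parts T) i) v ≡ 0ℙ
  out i = 𝟙-false (v ∈? lookup (parts T) i) (v∉ i)
... | inj₂ (i , u∈i , i-only) | inj₂ (j , v∈j , j-only) = begin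
  𝟙 (tricliqueAdj? u v T)
    ≡⟨ 𝟙-cong (tricliqueAdj? u v T) (¬? (i ≟ j))
         (λ (i′ , j′ , i′≢j′ , u∈ , v∈) i≡j →
            i′≢j′ (trans (i-only i′ u∈) (trans i≡j (sym (j-only j′ v∈)))))
         (λ i≢j → i , j , i≢j , u∈i , v∈j) ⟩
  𝟙 (¬? (i ≟ j))
    ≡⟨ form-values i j ⟩
  A i ⊗ B j ⊕ B i ⊗ A j
    ≡⟨ cong₂ _⊕_ (cong₂ _⊗_ (cong₂ _⊕_ (at u∈i i-only) (at u∈i i-only)) (cong₂ _⊕_ (at v∈j j-only) (at v∈j j-only)))
                 (cong₂ _⊗_ (cong₂ _⊕_ (at u∈i i-only) (at u∈i i-only)) (cong₂ _⊕_ (at v∈j j-only) (at v∈j j-only))) ⟨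
  _ ∎
  where
  open ≡-Reasoning
  -- The coordinates of a vertex depend only on its part, here `i`, which leaves a check of the nine
  -- pairs of parts by evaluation.
  A B : Fin 3 → 𝔽₂
  A i = 𝟙 (zero ≟ i) ⊕ 𝟙 (suc (suc zero) ≟ i)
  B i = 𝟙 (suc zero ≟ i) ⊕ 𝟙 (suc (suc zero) ≟ i)

  form-values : ∀ i j → 𝟙 (¬? (i ≟ j)) ≡ A i ⊗ B j ⊕ B i ⊗ A j
  form-values = from-yes (all? λ i → all? λ j → 𝟙 (¬? (i ≟ j)) ℙ.≟ A i ⊗ B j ⊕ B i ⊗ A j)

  at : ∀ {w i l} → w ∈ lookup (parts T) i → (∀ j → w ∈ lookup (parts T) j → j ≡ i) →
       χ (lookup (parts T) l) w ≡ 𝟙 (l ≟ i)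
  at {w} {i} {l} w∈i i-only =
    𝟙-cong (w ∈? lookup (parts T) l) (l ≟ i) (i-only l) λ { refl → w∈i }

-- The indicator polynomials of the points (1,0), (0,1) and (1,1) of the plane over 𝔽₂; all three
-- vanish at the origin.
membership : 𝔽₂ → 𝔽₂ → Fin 3 → 𝔽₂
membership p q zero             = p ⊗ (1ℙ ⊕ q)
membership p q (suc zero)       = q ⊗ (1ℙ ⊕ p)
membership p q (suc (suc zero)) = p ⊗ q

membership-unique? : ∀ p q →
  Dec (∀ i j → membership p q i ≡ 1ℙ → membership p q j ≡ 1ℙ → i ≡ j)
membership-unique? p q = all? λ i → all? λ j →
  membership p q i ℙ.≟ 1ℙ →-dec membership p q j ℙ.≟ 1ℙ →-dec i ≟ j

membership-unique : ∀ p q i j → membership p q i ≡ 1ℙ → membership p q j ≡ 1ℙ → i ≡ j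
membership-unique 0ℙ 0ℙ = from-yes (membership-unique? 0ℙ 0ℙ)
membership-unique 0ℙ 1ℙ = from-yes (membership-unique? 0ℙ 1ℙ)
membership-unique 1ℙ 0ℙ = from-yes (membership-unique? 1ℙ 0ℙ)
membership-unique 1ℙ 1ℙ = from-yes (membership-unique? 1ℙ 1ℙ)

-- The parts are the fibres of `u ↦ (a u , b u)` over the three nonzero points, hence disjoint. Thus
-- every hyperbolic form comes from a triclique.
fromCoordinates : Vector n × Vector n → Triclique n
fromCoordinates {n} (a , b) = triclique (tabulate part) disjoint
  where
  cell : Fin 3 → Fin n → 𝔽₂
  cell i u = membership (a u) (b u) i

  part : Fin 3 → Subset n
  part i = support (cell i)

  ∈-part : ∀ {u} i → u ∈ lookup (tabulate part) i → cell i u ≡ 1ℙ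
  ∈-part {u} i u∈ = ∈-support⁻ (cell i) (subst (u ∈_) (lookup∘tabulate part i) u∈)

  disjoint : ∀ i j → i ≢ j → Empty (lookup (tabulate part) i ∩ lookup (tabulate part) j)
  disjoint i j i≢j (u , u∈) with x∈p∩q⁻ (lookup (tabulate part) i) _ u∈
  ... | u∈i , u∈j = i≢j (membership-unique (a u) (b u) i j (∈-part i u∈i) (∈-part j u∈j))

coordinates-fromCoordinates₁ : (h : Vector n × Vector n) →
  proj₁ (coordinates (fromCoordinates h)) ≗ proj₁ h
coordinates-fromCoordinates₁ (a , b) u = trans (cong₂ _⊕_ (χ-support (λ w → membership (a w) (b w) zero) u)
                                   (χ-support (λ w → membership (a w) (b w) (suc (suc zero))) u))
  (solve 2 (λ p q → p :* (con 1ℙ :+ q) :+ p :* q := p) refl (a u) (b u))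

coordinates-fromCoordinates₂ : (h : Vector n × Vector n) →
  proj₂ (coordinates (fromCoordinates h)) ≗ proj₂ h
coordinates-fromCoordinates₂ (a , b) u = trans (cong₂ _⊕_ (χ-support (λ w → membership (a w) (b w) (suc zero)) u)
                                   (χ-support (λ w → membership (a w) (b w) (suc (suc zero))) u))
  (solve 2 (λ p q → q :* (con 1ℙ :+ p) :+ p :* q := q) refl (a u) (b u))

parity-tricliques : (𝒯 : Vec (Triclique n) k) → ∀ u v →
  parity (count (tricliqueAdj? u v) 𝒯) ≡ hyperbolics (map coordinates 𝒯) u v
parity-tricliques []      u v = refl
parity-tricliques (T ∷ 𝒯) u v = trans (parity-count (tricliqueAdj? u v) T 𝒯)
  (trans (cong₂ _⊕_ (triclique-hyperbolic T u v) (parity-tricliques 𝒯 u v))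
    (ℙ.+-assoc (proj₁ (coordinates T) u ⊗ proj₂ (coordinates T) v) _ _))

hyperbolics-fromCoordinates : (hs : Vec (Vector n × Vector n) k) → ∀ u v →
  hyperbolics (map coordinates (map fromCoordinates hs)) u v ≡ hyperbolics hs u v
hyperbolics-fromCoordinates []       u v = refl
hyperbolics-fromCoordinates (h ∷ hs) u v = cong₂ _⊕_
  (cong₂ _⊗_ (coordinates-fromCoordinates₁ h u) (coordinates-fromCoordinates₂ h v))
  (cong₂ _⊕_ (cong₂ _⊗_ (coordinates-fromCoordinates₂ h u) (coordinates-fromCoordinates₁ h v))
    (hyperbolics-fromCoordinates hs u v))

-- Comparison of `mr`, `c₂` and `t₂`.

Represents : Graph n → Form n → Set
Represents G F = ∀ u v → u ≢ v → Adj G u v ⇔ F u v ≡ 1ℙ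

represents-cong : (G : Graph n) {F F′ : Form n} → (∀ u v → F u v ≡ F′ u v) →
  Represents G F → Represents G F′
represents-cong G F≡F′ rep u v u≢v = subst (λ p → Adj G u v ⇔ p ≡ 1ℙ) (F≡F′ u v) (rep u v u≢v)

fits⇒represents : (G : Graph n) (M : Matrix n) → Fits G M → Represents G (M ⟦_,_⟧)
fits⇒represents G M fits u v u≢v = mk⇔
  (λ uv → ≢0⇒≡1 (from (fits u v u≢v) uv))
  (λ Muv≡1 → to (fits u v u≢v) λ Muv≡0 → contradiction (trans (sym Muv≡1) Muv≡0) λ ())

-- The tabulated sum of dyads is a symmetric matrix fitting `G`, and its rank is the size of an
-- independent family of rows, to which `dyads-rank` applies.
mr-upper-bound : (G : Graph n) (ps : Vec (Vector n × Vector n) m) →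
  (∀ u v → dyads ps u v ≡ dyads ps v u) → Represents G (dyads ps) → mr G ≤ m
mr-upper-bound {n} {m} G ps ps-sym rep = ℕ.≤-trans
  (proj₂ (proj₂ (mr-exists G)) (rank M) (M , M-sym , M-fits , refl))
  (dyads-rank ps (rank M) (independentRows-cong entry
    (hasIndependentRows⁻ M (proj₁ (proj₂ (rank-exists M))))))
  where
  M : Matrix n
  M = tabulate λ u → tabulate λ v → dyads ps u v

  entry : ∀ u v → M ⟦ u , v ⟧ ≡ dyads ps u v
  entry u v = trans (cong (λ r → lookup r v) (lookup∘tabulate _ u)) (lookup∘tabulate _ v)

  M-sym : IsSymmetric M
  M-sym u v = trans (entry u v) (trans (ps-sym u v) (sym (entry v u)))

  M-fits : Fits G M
  M-fits u v u≢v = mk⇔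
    (λ Muv≢0 → from (rep u v u≢v) (trans (sym (entry u v)) (≢0⇒≡1 Muv≢0)))
    (λ uv Muv≡0 → contradiction (trans (sym (to (rep u v u≢v) uv)) (trans (sym (entry u v)) Muv≡0)) λ ())

mr≤c₂ : (G : Graph n) → mr G ≤ c₂ G
mr≤c₂ G with proj₁ (proj₂ (c₂-exists G))
... | 𝒞 , system = mr-upper-bound G (map (λ s → s , s) (map χ 𝒞)) (squares-sym (map χ 𝒞))
  (represents-cong G (parity-cliques 𝒞) system)

mr≤2t₂ : (G : Graph n) → mr G ≤ 2 * t₂ G
mr≤2t₂ G with proj₁ (proj₂ (t₂-exists G))
... | 𝒯 , system = subst (mr G ≤_) (ℕ.*-comm (t₂ G) 2) (mr-upper-bound G (hyperbolicPairs (map coordinates 𝒯))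
  (hyperbolics-sym (map coordinates 𝒯)) (represents-cong G (parity-tricliques 𝒯) system))

c₂-upper-bound : (G : Graph n) (ss : Vec (Vector n) k) → Represents G (squares ss) → c₂ G ≤ k
c₂-upper-bound G ss rep = proj₂ (proj₂ (c₂-exists G)) _ (map support ss ,
  represents-cong G (λ u v → sym (trans (parity-cliques (map support ss) u v) (squares-support ss u v))) rep)

t₂-upper-bound : (G : Graph n) (hs : Vec (Vector n × Vector n) k) →
  Represents G (hyperbolics hs) → t₂ G ≤ k
t₂-upper-bound G hs rep = proj₂ (proj₂ (t₂-exists G)) _ (map fromCoordinates hs ,
  represents-cong G (λ u v → sym (trans (parity-tricliques (map fromCoordinates hs) u v)
    (hyperbolics-fromCoordinates hs u v))) rep)

-- A matrix attaining `mr G` is decomposed. Squares turn into a subgraph complementation system and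
-- hyperbolic forms into a triclique system, so either outcome bounds one side of the minimum.
mr-lower-bound : (G : Graph n) → c₂ G ⊓ (2 * t₂ G) ≤ mr G
mr-lower-bound G with proj₁ (proj₂ (mr-exists G))
... | M , M-sym , M-fits , rank≡mr
  with symmetric-decomposition (mr G) (M ⟦_,_⟧) M-sym
    (λ k ind → subst (k ≤_) rank≡mr (proj₂ (proj₂ (rank-exists M)) k (hasIndependentRows⁺ M ind)))
... | inj₁ (k , k≤mr , ss , eq) = ℕ.≤-trans (ℕ.m⊓n≤m _ _)
  (ℕ.≤-trans (c₂-upper-bound G ss (represents-cong G eq (fits⇒represents G M M-fits))) k≤mr)
... | inj₂ (t , 2t≤mr , hs , eq) = ℕ.≤-trans (ℕ.m⊓n≤n _ _) (ℕ.≤-trans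
  (ℕ.*-monoʳ-≤ 2 (t₂-upper-bound G hs (represents-cong G eq (fits⇒represents G M M-fits))))
  (subst (_≤ mr G) (ℕ.*-comm t 2) 2t≤mr))

theorem4p14 : ∀ {n : ℕ} (G : Graph n) → mr G ≡ c₂ G ⊓ (2 * t₂ G)
theorem4p14 G = ℕ.≤-antisym (ℕ.⊓-glb (mr≤c₂ G) (mr≤2t₂ G)) (mr-lower-bound G)
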